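{- Let $\langle A,\to\rangle$ be a conditional algebra. There exists a dual lattice isomorphism between the lattice of congruences of $\langle A,\to\rangle$ and the lattice (ordered by inclusion) of $T_A$-closed subsets of the expanded Stone space $\langle\mathrm{Ul}(A),\tau_s,T_A\rangle$.
   Context: A conditional algebra is $\langle A,\to\rangle$ with $A$ a Boolean algebra and $\to$ binary with $a\to1=1$, $(a\to b)\wedge(a\to c)=a\to(b\wedge c)$, $(a\vee b)\to c\le(a\to c)\wedge(b\to c)$. $\mathrm{Ul}(A)$ is the Stone space of ultrafilters; closed sets are $\varphi(F)=\{u:F\subseteq u\}$ for filters $F$ (including $F=A$). $D^{\to}_u(F)=\{b:\exists a\in F,\ a\to b\in u\}$; $T_A(u,Z,v)$ iff there is a filter $F$ with $Z=\varphi(F)$ and $D^{\to}_u(F)\subseteq v$. For ultrafilters $x,y$, $\mathbf{C}(x,y)$ is the set of closed $Z$ with $T_A(x,Z,y)$. A closed set $Y$ is $T_A$-closed if for all $x,y$: if $x\in Y$ and $Z$ is a minimal element of $\mathbf{C}(x,y)$ under inclusion, then $Z\subseteq Y$ and $y\in Y$. -}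

module Defs where

open import Algebra.Core using (Op₂)
open import Algebra.Lattice.Bundles using (BooleanAlgebra)
open import Algebra.Lattice.Morphism.Structures using (IsLatticeIsomorphism)
open import Data.Product.Base using (∃-syntax; _×_; _,_; proj₁)
open import Data.Sum.Base using (_⊎_)
open import Level using (_⊔_) renaming (suc to lsuc)
open import Relation.Binary.Bundles using (Poset)
open import Relation.Binary.Core using (Rel; _⇒_)
open import Relation.Binary.Lattice using (Lattice; IsLattice)
open import Relation.Binary.Structures using (IsEquivalence)
open import Relation.Unary using (Pred; _∈_; _∉_; _⊆_; _≐_)
import Algebra.Definitions
import Algebra.Lattice.Bundles
import Algebra.Lattice.Properties.Lattice as AlgebraicLattice
import Relation.Binary.Lattice.Properties.Lattice as OrderLattice

-- Zorn's lemma for partial orders over a setoid.  It is not derivable in Agda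
-- and is only ever used as an explicit hypothesis.  The empty chain is allowed,
-- so the premise forces the order to be inhabited.
ZornsLemma : ∀ a ℓ₁ ℓ₂ p → Set (lsuc (a ⊔ ℓ₁ ⊔ ℓ₂ ⊔ p))
ZornsLemma a ℓ₁ ℓ₂ p = (P : Poset a ℓ₁ ℓ₂) → let open Poset P in
  ((C : Pred Carrier p) →
    (∀ {x y} → x ∈ C → y ∈ C → (x ≤ y) ⊎ (y ≤ x)) →
    ∃[ u ] (∀ {x} → x ∈ C → x ≤ u)) →
  ∃[ m ] (∀ {x} → m ≤ x → x ≤ m)

-- "The poset P is a lattice"; the operations are determined up to _≈_ by P.
record LatticeOn {a ℓ₁ ℓ₂} (P : Poset a ℓ₁ ℓ₂) : Set (a ⊔ ℓ₁ ⊔ ℓ₂) where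
  open Poset P using (Carrier; _≈_; _≤_)
  field
    _∨_       : Op₂ Carrier
    _∧_       : Op₂ Carrier
    isLattice : IsLattice _≈_ _≤_ _∨_ _∧_

  lattice : Lattice a ℓ₁ ℓ₂
  lattice = record { isLattice = isLattice }

IsDualLatticeIsomorphism :
  ∀ {a ℓ₁ ℓ₂ b m₁ m₂} (L : Lattice a ℓ₁ ℓ₂) (M : Lattice b m₁ m₂) →
  (Lattice.Carrier L → Lattice.Carrier M) → Set (a ⊔ ℓ₁ ⊔ b ⊔ m₁)
IsDualLatticeIsomorphism L M =
  IsLatticeIsomorphism (raw L) (raw (OrderLattice.∧-∨-lattice M))
  where
  raw : ∀ {a ℓ₁ ℓ₂} → Lattice a ℓ₁ ℓ₂ → Algebra.Lattice.Bundles.RawLattice a ℓ₁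
  raw K = Algebra.Lattice.Bundles.Lattice.rawLattice (OrderLattice.algLattice K)

record ConditionalAlgebra c ℓ : Set (lsuc (c ⊔ ℓ)) where
  infixr 5 _⟶_
  field
    booleanAlgebra : BooleanAlgebra c ℓ

  open BooleanAlgebra booleanAlgebra public renaming (¬_ to ∁_; ¬-cong to ∁-cong)
  open Poset (AlgebraicLattice.poset lattice) public using (_≤_)
  open Algebra.Definitions _≈_ using (Congruent₂)

  field
    _⟶_           : Op₂ Carrier
    ⟶-cong        : Congruent₂ _⟶_
    ⟶-⊤           : ∀ a → (a ⟶ ⊤) ≈ ⊤
    ⟶-∧           : ∀ a b c → ((a ⟶ b) ∧ (a ⟶ c)) ≈ (a ⟶ (b ∧ c))
    ∨-⟶           : ∀ a b c → ((a ∨ b) ⟶ c) ≤ ((a ⟶ c) ∧ (b ⟶ c))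

module _ {c ℓ} (𝐀 : ConditionalAlgebra c ℓ) where
  open ConditionalAlgebra 𝐀

  -- ≈⇒∼ says that _∼_ is a relation on the carrier taken modulo _≈_;
  -- compatibility with the constants ⊤ and ⊥ is an instance of reflexivity.
  record Congruence : Set (lsuc (c ⊔ ℓ)) where
    field
      _∼_           : Rel Carrier (c ⊔ ℓ)
      isEquivalence : IsEquivalence _∼_
      ≈⇒∼           : _≈_ ⇒ _∼_
    open Algebra.Definitions _∼_ using (Congruent₁; Congruent₂)
    field
      ∨-compat      : Congruent₂ _∨_
      ∧-compat      : Congruent₂ _∧_
      ∁-compat      : Congruent₁ ∁_
      ⟶-compat      : Congruent₂ _⟶_

  congruencePoset : Poset (lsuc (c ⊔ ℓ)) (c ⊔ ℓ) (c ⊔ ℓ)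
  congruencePoset = record
    { Carrier = Congruence
    ; _≈_     = λ θ ψ → (rel θ ⇒ rel ψ) × (rel ψ ⇒ rel θ)
    ; _≤_     = λ θ ψ → rel θ ⇒ rel ψ
    ; isPartialOrder = record
      { isPreorder = record
        { isEquivalence = record
          { refl  = (λ p → p) , (λ p → p)
          ; sym   = λ (f , g) → g , f
          ; trans = λ (f , g) (h , k) → (λ p → h (f p)) , (λ p → g (k p))
          }
        ; reflexive = proj₁
        ; trans     = λ f g p → g (f p)
        }
      ; antisym = _,_
      }
    }
    where
    rel : Congruence → Rel Carrier (c ⊔ ℓ)
    rel = Congruence._∼_

  -- The improper filter is included.
  record Filter : Set (lsuc (c ⊔ ℓ)) where
    field
      members  : Pred Carrier (c ⊔ ℓ)
      ⊤-mem    : ⊤ ∈ members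
      ∧-mem    : ∀ {a b} → a ∈ members → b ∈ members → (a ∧ b) ∈ members
      upward   : ∀ {a b} → a ≤ b → a ∈ members → b ∈ members

  open Filter public using (members)

  Proper : Filter → Set (c ⊔ ℓ)
  Proper F = ⊥ ∉ members F

  record Ultrafilter : Set (lsuc (c ⊔ ℓ)) where
    field
      filter  : Filter
      proper  : Proper filter
      maximal : ∀ G → Proper G → members filter ⊆ members G → members G ⊆ members filter

    elements : Pred Carrier (c ⊔ ℓ)
    elements = members filter

  open Ultrafilter public using (elements)

  -- Ultrafilters are identified when they have the same elements; closed sets,
  -- being of the form φ F, respect that identification.
  Subset : Set (lsuc (c ⊔ ℓ))
  Subset = Pred Ultrafilter (c ⊔ ℓ)

  φ : Filter → Subset
  φ F u = members F ⊆ elements u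

  IsClosed : Subset → Set (lsuc (c ⊔ ℓ))
  IsClosed Z = ∃[ F ] Z ≐ φ F

  D : Ultrafilter → Filter → Pred Carrier (c ⊔ ℓ)
  D u F b = ∃[ a ] (a ∈ members F × (a ⟶ b) ∈ elements u)

  T : Ultrafilter → Subset → Ultrafilter → Set (lsuc (c ⊔ ℓ))
  T u Z v = ∃[ F ] (Z ≐ φ F × D u F ⊆ elements v)

  𝐂 : Ultrafilter → Ultrafilter → Pred Subset (lsuc (c ⊔ ℓ))
  𝐂 x y Z = IsClosed Z × T x Z y

  IsMinimalIn : ∀ {p} → Pred Subset p → Subset → Set (p ⊔ lsuc (c ⊔ ℓ))
  IsMinimalIn 𝒮 Z = Z ∈ 𝒮 × (∀ W → W ∈ 𝒮 → W ⊆ Z → Z ⊆ W)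

  record TClosedSet : Set (lsuc (c ⊔ ℓ)) where
    field
      points  : Subset
      closed  : IsClosed points
      Tclosed : ∀ x y Z → x ∈ points → IsMinimalIn (𝐂 x y) Z → Z ⊆ points × y ∈ points

  TClosedPoset : Poset (lsuc (c ⊔ ℓ)) (lsuc (c ⊔ ℓ)) (lsuc (c ⊔ ℓ))
  TClosedPoset = record
    { Carrier = TClosedSet
    ; _≈_     = λ X Y → points X ≐ points Y
    ; _≤_     = λ X Y → points X ⊆ points Y
    ; isPartialOrder = record
      { isPreorder = record
        { isEquivalence = record
          { refl  = (λ p → p) , (λ p → p)
          ; sym   = λ (f , g) → g , f
          ; trans = λ (f , g) (h , k) → (λ p → h (f p)) , (λ p → g (k p))
          }
        ; reflexive = proj₁
        ; trans     = λ f g p → g (f p)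
        }
      ; antisym = _,_
      }
    }
    where open TClosedSet using (points)

{-# OPTIONS --safe #-}

-- A congruence θ corresponds to the closed set of ultrafilters containing the
-- filter { a ∣ a θ ⊤ }.  If Z = φ G is minimal in 𝐂 x y and x contains that
-- filter F, then G may be enlarged by F without leaving 𝐂 x y, so Z ⊆ φ F.
-- Conversely, a closed set Y identifies a and b when its points do.  If
-- b ⟶ d ∉ x, the ultrafilter theorem yields y avoiding d with φ (↑ b) ∈ 𝐂 x y,
-- and Zorn's lemma a minimal member of 𝐂 x y below φ (↑ b); T-closedness places
-- it, and y, inside Y, which refutes a ⟶ c ∈ x whenever Y identifies a with b
-- and c with d.
module Submission where

open import Defs
open import Algebra.Lattice.Bundles using (module Lattice)
open import Axiom.ExcludedMiddle using (ExcludedMiddle)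
open import Data.Product.Base using (Σ-syntax; ∃-syntax; _×_; _,_; proj₁; proj₂; swap)
open import Data.Sum.Base using (_⊎_; inj₁; inj₂)
open import Level using (Lift; lift; lower; 0ℓ; _⊔_) renaming (suc to lsuc)
open import Relation.Binary.Bundles using (Poset)
open import Relation.Binary.Lattice using (IsLattice)
open import Relation.Binary.PropositionalEquality.Core using (_≡_) renaming (refl to ≡-refl)
open import Relation.Binary.Structures using (IsEquivalence)
open import Relation.Nullary using (¬_; Dec; yes; no; contradiction)
open import Relation.Nullary.Decidable using (True; toWitness; fromWitness; decidable-stable)
open import Relation.Unary using (Pred; _∈_; _∉_; _⊆_; _≐_)
import Algebra.Lattice.Properties.BooleanAlgebra as BooleanAlgebraProperties
import Algebra.Lattice.Properties.Lattice as LatticeProperties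
import Relation.Binary.Lattice.Properties.Lattice as OrderLatticeProperties
import Relation.Binary.Reasoning.Setoid as SetoidReasoning

-- Lattice structure carried across an order-reversing bijection.

module DualTransfer
  {a ℓ₁ ℓ₂ b m₁ m₂} {P : Poset a ℓ₁ ℓ₂} {Q : Poset b m₁ m₂} (L : LatticeOn P)
  (f : Poset.Carrier P → Poset.Carrier Q) (g : Poset.Carrier Q → Poset.Carrier P)
  (f-anti : ∀ x y → Poset._≤_ P x y → Poset._≤_ Q (f y) (f x))
  (g-anti : ∀ x y → Poset._≤_ Q x y → Poset._≤_ P (g y) (g x))
  (f∘g : ∀ y → Poset._≈_ Q (f (g y)) y)
  (g∘f : ∀ x → Poset._≈_ P (g (f x)) x)
  where

  private
    module P = Poset P
    module Q = Poset Q
    open module L = LatticeOn L using (_∨_; _∧_)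
    open IsLattice L.isLattice using (x≤x∨y; y≤x∨y; ∨-least; x∧y≤x; x∧y≤y; ∧-greatest)
    module A = Lattice (OrderLatticeProperties.algLattice L.lattice)

    f-cong : ∀ {x y} → x P.≈ y → f x Q.≈ f y
    f-cong x≈y = Q.antisym (f-anti _ _ (P.reflexive (P.Eq.sym x≈y))) (f-anti _ _ (P.reflexive x≈y))

    g-cong : ∀ {x y} → x Q.≈ y → g x P.≈ g y
    g-cong x≈y = P.antisym (g-anti _ _ (Q.reflexive (Q.Eq.sym x≈y))) (g-anti _ _ (Q.reflexive x≈y))

    below : ∀ {x y} → y P.≤ g x → x Q.≤ f y
    below {x} y≤gx = Q.trans (Q.reflexive (Q.Eq.sym (f∘g x))) (f-anti _ _ y≤gx)

    above : ∀ {x y} → g x P.≤ y → f y Q.≤ x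
    above {x} gx≤y = Q.trans (f-anti _ _ gx≤y) (Q.reflexive (f∘g x))

  -- Transport spares a direct construction of joins and meets in `Q`; the homomorphism laws then
  -- only cancel `g` after `f`.
  latticeOn : LatticeOn Q
  latticeOn = record
    { _∨_       = λ x y → f (g x ∧ g y)
    ; _∧_       = λ x y → f (g x ∨ g y)
    ; isLattice = record
      { isPartialOrder = Q.isPartialOrder
      ; supremum = λ x y →
          below (x∧y≤x _ _) , below (x∧y≤y _ _) ,
          λ z x≤z y≤z → above (∧-greatest (g-anti _ _ x≤z) (g-anti _ _ y≤z))
      ; infimum = λ x y →
          above (x≤x∨y _ _) , above (y≤x∨y _ _) ,
          λ z z≤x z≤y → below (∨-least (g-anti _ _ z≤x) (g-anti _ _ z≤y))
      }
    }

  isDualLatticeIsomorphism :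
    IsDualLatticeIsomorphism (LatticeOn.lattice L) (LatticeOn.lattice latticeOn) f
  isDualLatticeIsomorphism = record
    { isLatticeMonomorphism = record
      { isLatticeHomomorphism = record
        { isRelHomomorphism = record { cong = f-cong }
        ; ∧-homo = λ x y → f-cong (A.∧-cong (P.Eq.sym (g∘f x)) (P.Eq.sym (g∘f y)))
        ; ∨-homo = λ x y → f-cong (A.∨-cong (P.Eq.sym (g∘f x)) (P.Eq.sym (g∘f y)))
        }
      ; injective = λ {x} {y} fx≈fy →
          P.Eq.trans (P.Eq.sym (g∘f x)) (P.Eq.trans (g-cong fx≈fy) (g∘f y))
      }
    ; surjective = λ y → g y , λ z≈gy → Q.Eq.trans (f-cong z≈gy) (f∘g y)
    }

-- Boolean identities, monotonicity of the conditional, and filters.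

module FilterOperations {c ℓ} (𝐀 : ConditionalAlgebra c ℓ) where
  open ConditionalAlgebra 𝐀
  open BooleanAlgebraProperties booleanAlgebra
    using (∧-identityʳ; ∨-identityˡ; ∨-zeroʳ; ¬-involutive)
  open IsLattice (LatticeProperties.∨-∧-isOrderTheoreticLattice lattice)
    using (x≤x∨y; y≤x∨y; ∨-least; x∧y≤x; x∧y≤y; ∧-greatest; antisym)
    renaming (reflexive to ≤-reflexive; refl to ≤-refl; trans to ≤-trans) public

  ∧-mono : ∀ {a b a′ b′} → a ≤ a′ → b ≤ b′ → a ∧ b ≤ a′ ∧ b′
  ∧-mono a≤a′ b≤b′ =
    ∧-greatest (≤-trans (x∧y≤x _ _) a≤a′) (≤-trans (x∧y≤y _ _) b≤b′)

  x≤⊤ : ∀ x → x ≤ ⊤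
  x≤⊤ x = sym (∧-identityʳ x)

  ∨-absorbs-≤ : ∀ {a b} → a ≤ b → a ∨ b ≈ b
  ∨-absorbs-≤ a≤b = antisym (∨-least a≤b ≤-refl) (y≤x∨y _ _)

  -- Boolean modus ponens, used both inside an ultrafilter and modulo a congruence.
  x∧[∁x∨y]≈x∧y : ∀ x y → x ∧ (∁ x ∨ y) ≈ x ∧ y
  x∧[∁x∨y]≈x∧y x y = begin
    x ∧ (∁ x ∨ y)      ≈⟨ ∧-distribˡ-∨ x (∁ x) y ⟩
    x ∧ ∁ x ∨ x ∧ y    ≈⟨ ∨-congʳ (∧-complementʳ x) ⟩
    ⊥ ∨ x ∧ y          ≈⟨ ∨-identityˡ (x ∧ y) ⟩
    x ∧ y              ∎
    where open SetoidReasoning setoid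

  ∧-⊥⇒≤∁ : ∀ {a b} → a ∧ b ≤ ⊥ → a ≤ ∁ b
  ∧-⊥⇒≤∁ {a} {b} a∧b≤⊥ = ≤-trans (≤-reflexive a≈) (∨-least (≤-trans a∧b≤⊥ ⊥≤) (x∧y≤y _ _))
    where
    ⊥≤ : ⊥ ≤ ∁ b
    ⊥≤ = ≤-trans (x≤x∨y ⊥ (∁ b)) (≤-reflexive (∨-identityˡ (∁ b)))
    a≈ : a ≈ a ∧ b ∨ a ∧ ∁ b
    a≈ = begin
      a                  ≈⟨ ∧-identityʳ a ⟨
      a ∧ ⊤              ≈⟨ ∧-congˡ (∨-complementʳ b) ⟨
      a ∧ (b ∨ ∁ b)      ≈⟨ ∧-distribˡ-∨ a b (∁ b) ⟩
      a ∧ b ∨ a ∧ ∁ b    ∎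
      where open SetoidReasoning setoid

  ∧-∁-⊥⇒≤ : ∀ {a b} → a ∧ ∁ b ≤ ⊥ → a ≤ b
  ∧-∁-⊥⇒≤ a∧∁b≤⊥ = ≤-trans (∧-⊥⇒≤∁ a∧∁b≤⊥) (≤-reflexive (¬-involutive _))

  -- As `b ≤ d` unfolds to `b ≈ b ∧ d`, distributing the conditional over that meet already yields
  -- the inequality.
  ⟶-monoʳ : ∀ a {b d} → b ≤ d → a ⟶ b ≤ a ⟶ d
  ⟶-monoʳ a b≤d = trans (⟶-cong refl b≤d) (sym (⟶-∧ _ _ _))

  ⟶-antiˡ : ∀ {a b} d → a ≤ b → b ⟶ d ≤ a ⟶ d
  ⟶-antiˡ d a≤b =
    ≤-trans (≤-reflexive (⟶-cong (sym (∨-absorbs-≤ a≤b)) refl)) (≤-trans (∨-⟶ _ _ _) (x∧y≤x _ _))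

  ≈-mem : (F : Filter 𝐀) → ∀ {a b} → a ≈ b → a ∈ members F → b ∈ members F
  ≈-mem F a≈b = Filter.upward F (≤-reflexive a≈b)

  ↑ : Carrier → Filter 𝐀
  ↑ a = record
    { members = λ b → Lift (c ⊔ ℓ) (a ≤ b)
    ; ⊤-mem   = lift (x≤⊤ a)
    ; ∧-mem   = λ (lift a≤b) (lift a≤d) → lift (∧-greatest a≤b a≤d)
    ; upward  = λ b≤d (lift a≤b) → lift (≤-trans a≤b b≤d)
    }

  infixr 6 _∨ᶠ_
  -- Dually, `φ` turns this join into the intersection of the two closed sets.
  _∨ᶠ_ : Filter 𝐀 → Filter 𝐀 → Filter 𝐀
  F ∨ᶠ G = record
    { members = λ a → ∃[ f ] ∃[ g ] (f ∈ members F × g ∈ members G × f ∧ g ≤ a)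
    ; ⊤-mem   = ⊤ , ⊤ , F.⊤-mem , G.⊤-mem , x≤⊤ _
    ; ∧-mem   = λ (f , g , f∈F , g∈G , fg≤a) (f′ , g′ , f′∈F , g′∈G , f′g′≤b) →
        f ∧ f′ , g ∧ g′ , F.∧-mem f∈F f′∈F , G.∧-mem g∈G g′∈G ,
        ∧-greatest (≤-trans (∧-mono (x∧y≤x _ _) (x∧y≤x _ _)) fg≤a)
                   (≤-trans (∧-mono (x∧y≤y _ _) (x∧y≤y _ _)) f′g′≤b)
    ; upward  = λ a≤b (f , g , f∈F , g∈G , fg≤a) → f , g , f∈F , g∈G , ≤-trans fg≤a a≤b
    }
    where
    module F = Filter F
    module G = Filter G

  ⊆-∨ᶠˡ : ∀ F G → members F ⊆ members (F ∨ᶠ G)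
  ⊆-∨ᶠˡ F G f∈F = _ , ⊤ , f∈F , Filter.⊤-mem G , x∧y≤x _ _

  ⊆-∨ᶠʳ : ∀ F G → members G ⊆ members (F ∨ᶠ G)
  ⊆-∨ᶠʳ F G g∈G = ⊤ , _ , Filter.⊤-mem F , g∈G , x∧y≤y _ _

  -- Antitonicity moves conditionals with antecedents `f` and `g` to the common antecedent `f ∧ g`,
  -- where their consequents can be met.
  D-filter : Ultrafilter 𝐀 → Filter 𝐀 → Filter 𝐀
  D-filter u F = record
    { members = D 𝐀 u F
    ; ⊤-mem   = ⊤ , F.⊤-mem , ≈-mem (Ultrafilter.filter u) (sym (⟶-⊤ ⊤)) u.⊤-mem
    ; ∧-mem   = λ (f , f∈F , f⟶a∈u) (g , g∈F , g⟶b∈u) →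
        f ∧ g , F.∧-mem f∈F g∈F ,
        ≈-mem (Ultrafilter.filter u) (⟶-∧ _ _ _)
          (u.∧-mem (u.upward (⟶-antiˡ _ (x∧y≤x f g)) f⟶a∈u)
                   (u.upward (⟶-antiˡ _ (x∧y≤y f g)) g⟶b∈u))
    ; upward  = λ a≤b (f , f∈F , f⟶a∈u) → f , f∈F , u.upward (⟶-monoʳ f a≤b) f⟶a∈u
    }
    where
    module F = Filter F
    module u = Filter (Ultrafilter.filter u)

  -- From congruences to T-closed sets.

  ⊤-class : Congruence 𝐀 → Filter 𝐀
  ⊤-class θ = record
    { members = _∼ ⊤
    ; ⊤-mem   = ∼.refl
    ; ∧-mem   = λ a∼⊤ b∼⊤ → ∼.trans (∧-compat a∼⊤ b∼⊤) (≈⇒∼ (∧-identityʳ ⊤))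
    ; upward  = λ {a} {b} a≤b a∼⊤ →
        ∼.trans (≈⇒∼ (sym (trans (∨-comm b a) (∨-absorbs-≤ a≤b))))
                (∼.trans (∨-compat ∼.refl a∼⊤) (≈⇒∼ (∨-zeroʳ b)))
    }
    where
    open Congruence θ
    module ∼ = IsEquivalence (Congruence.isEquivalence θ)

  -- Replacing `b` by the related `a` turns the implication into `∁ a ∨ a`.
  ∼⇒∁∨∼⊤ : (θ : Congruence 𝐀) → let open Congruence θ in ∀ {a b} → a ∼ b → (∁ a ∨ b) ∼ ⊤
  ∼⇒∁∨∼⊤ θ {a} a∼b =
    ∼.trans (∨-compat ∼.refl (∼.sym a∼b)) (≈⇒∼ (∨-complementˡ a))
    where
    open Congruence θ
    module ∼ = IsEquivalence (Congruence.isEquivalence θ)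

  -- Modulo `θ`, each implication identifies one side with `a ∧ b`. Together with the converse, this
  -- shows that the class of `⊤` determines the congruence.
  ∁∨∼⊤⇒∼ : (θ : Congruence 𝐀) → let open Congruence θ in
    ∀ {a b} → (∁ a ∨ b) ∼ ⊤ → (∁ b ∨ a) ∼ ⊤ → a ∼ b
  ∁∨∼⊤⇒∼ θ {a} {b} a⇒b b⇒a =
    ∼.trans (meet a⇒b) (∼.trans (≈⇒∼ (∧-comm a b)) (∼.sym (meet b⇒a)))
    where
    open Congruence θ
    module ∼ = IsEquivalence (Congruence.isEquivalence θ)
    meet : ∀ {x y} → (∁ x ∨ y) ∼ ⊤ → x ∼ (x ∧ y)
    meet {x} {y} x⇒y =
      ∼.trans (≈⇒∼ (sym (∧-identityʳ x)))
        (∼.trans (∧-compat ∼.refl (∼.sym x⇒y)) (≈⇒∼ (x∧[∁x∨y]≈x∧y x y)))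

  congruenceToTClosed : Congruence 𝐀 → TClosedSet 𝐀
  congruenceToTClosed θ = record
    { points  = φ 𝐀 F
    ; closed  = F , (λ p → p) , (λ p → p)
    ; Tclosed = λ x y Z x∈Y → λ where
        ((_ , G , Z≐φG , D⊆y) , minimal) →
          (λ {u} u∈Z {a} a∈F →
            minimal (φ 𝐀 (G ∨ᶠ F)) (∨ᶠ∈𝐂 x y x∈Y G D⊆y)
              (λ {v} v∈ → proj₂ Z≐φG (λ g∈G → v∈ (⊆-∨ᶠˡ G F g∈G))) u∈Z (⊆-∨ᶠʳ G F a∈F)) ,
          -- The antecedent `⊤` lies in every filter, and `⊤ ⟶ b` is related to `⊤ ⟶ ⊤`, hence to
          -- `⊤`, so it belongs to `x`.
          λ b∈F → D⊆y (⊤ , Filter.⊤-mem G ,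
            x∈Y (∼.trans (⟶-compat ∼.refl b∈F) (≈⇒∼ (⟶-⊤ ⊤))))
    }
    where
    open Congruence θ
    module ∼ = IsEquivalence (Congruence.isEquivalence θ)
    F = ⊤-class θ
    -- Since `f` is related to `⊤`, so is the implication from `(g ∧ f) ⟶ d` to `g ⟶ d`. It
    -- therefore lies in `x`, and the antecedent can be brought back into `G`.
    ∨ᶠ∈𝐂 : ∀ x y → x ∈ φ 𝐀 F → ∀ G → D 𝐀 x G ⊆ elements y → φ 𝐀 (G ∨ᶠ F) ∈ 𝐂 𝐀 x y
    ∨ᶠ∈𝐂 x y x∈Y G D⊆y =
      (G ∨ᶠ F , (λ p → p) , (λ p → p)) , G ∨ᶠ F , ((λ p → p) , (λ p → p)) ,
      λ {d} (a , (g , f , g∈G , f∼⊤ , gf≤a) , a⟶d∈x) → D⊆y (g , g∈G ,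
        let gf∼g = ∼.trans (∧-compat ∼.refl f∼⊤) (≈⇒∼ (∧-identityʳ g))
            x-filter = Ultrafilter.filter x
        in Filter.upward x-filter
             (≤-trans (≤-reflexive (x∧[∁x∨y]≈x∧y ((g ∧ f) ⟶ d) (g ⟶ d))) (x∧y≤y _ _))
             (Filter.∧-mem x-filter (Filter.upward x-filter (⟶-antiˡ d gf≤a) a⟶d∈x)
               (x∈Y (∼⇒∁∨∼⊤ θ (⟶-compat gf∼g ∼.refl)))))

-- Maximal filters from excluded middle and Zorn's lemma.

module ClassicalDuality
  (em : ∀ {a} → ExcludedMiddle a)
  (zorn : ∀ {a ℓ₁ ℓ₂ p} → ZornsLemma a ℓ₁ ℓ₂ p)
  {c ℓ} (𝐀 : ConditionalAlgebra c ℓ)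
  where

  open ConditionalAlgebra 𝐀
  open BooleanAlgebraProperties booleanAlgebra using (deMorgan₂)
  open FilterOperations 𝐀

  -- Excluded middle collapses every proposition to the level at which filters
  -- and congruences take their values, so impredicative definitions are available.
  Resize : ∀ {a} → Set a → Set (c ⊔ ℓ)
  Resize P = Lift (c ⊔ ℓ) (True (em {P = P}))

  resize : ∀ {a} {P : Set a} → P → Resize P
  resize {P = P} p = lift (fromWitness {a? = em {P = P}} p)

  unresize : ∀ {a} {P : Set a} → Resize P → P
  unresize {P = P} p = toWitness {a? = em {P = P}} (lower p)

  module _ {q} (Q : Pred Carrier q) (F : Filter 𝐀) (F⊆Q : members F ⊆ Q) where

    private
      Between : Set (lsuc (c ⊔ ℓ) ⊔ q)
      Between = Σ[ G ∈ Filter 𝐀 ] (members F ⊆ members G × members G ⊆ Q)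

      elem : Between → Pred Carrier (c ⊔ ℓ)
      elem X = members (proj₁ X)

      least : Between
      least = F , (λ p → p) , F⊆Q

      order : Poset (lsuc (c ⊔ ℓ) ⊔ q) (c ⊔ ℓ) (c ⊔ ℓ)
      order = record
        { Carrier = Between
        ; _≈_     = λ X Y → elem X ≐ elem Y
        ; _≤_     = λ X Y → elem X ⊆ elem Y
        ; isPartialOrder = record
          { isPreorder = record
            { isEquivalence = record
              { refl  = (λ p → p) , (λ p → p)
              ; sym   = swap
              ; trans = λ (f , g) (h , k) → (λ p → h (f p)) , (λ p → g (k p))
              }
            ; reflexive = proj₁
            ; trans     = λ f g p → g (f p)
            }
          ; antisym = _,_
          }
        }

      module Union (C : Pred Between 0ℓ)
        (chain : ∀ {X Y} → X ∈ C → Y ∈ C → (elem X ⊆ elem Y) ⊎ (elem Y ⊆ elem X)) where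

        -- Adjoining the least element covers the empty chain.
        C⁺ : Pred Between (lsuc (c ⊔ ℓ) ⊔ q)
        C⁺ X = X ∈ C ⊎ X ≡ least

        chain⁺ : ∀ X Y → X ∈ C⁺ → Y ∈ C⁺ → (elem X ⊆ elem Y) ⊎ (elem Y ⊆ elem X)
        chain⁺ X Y (inj₁ X∈C)    (inj₁ Y∈C)    = chain X∈C Y∈C
        chain⁺ X Y (inj₂ ≡-refl) _             = inj₁ (proj₁ (proj₂ Y))
        chain⁺ X Y (inj₁ _)      (inj₂ ≡-refl) = inj₂ (proj₁ (proj₂ X))

        ⋃ : Pred Carrier (lsuc (c ⊔ ℓ) ⊔ q)
        ⋃ a = ∃[ X ] (X ∈ C⁺ × a ∈ elem X)

        ⋃-∧ : ∀ {a b} → a ∈ ⋃ → b ∈ ⋃ → (a ∧ b) ∈ ⋃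
        ⋃-∧ (X , X∈ , a∈X) (Y , Y∈ , b∈Y) with chain⁺ X Y X∈ Y∈
        ... | inj₁ X⊆Y = Y , Y∈ , Filter.∧-mem (proj₁ Y) (X⊆Y a∈X) b∈Y
        ... | inj₂ Y⊆X = X , X∈ , Filter.∧-mem (proj₁ X) a∈X (Y⊆X b∈Y)

        -- The union quantifies over filters and so lives in a larger universe; resizing returns it
        -- to the level of `members`.
        ⋃-filter : Filter 𝐀
        ⋃-filter = record
          { members = λ a → Resize (a ∈ ⋃)
          ; ⊤-mem   = resize (least , inj₂ ≡-refl , Filter.⊤-mem F)
          ; ∧-mem   = λ a∈ b∈ → resize (⋃-∧ (unresize a∈) (unresize b∈))
          ; upward  = λ a≤b a∈ → let X , X∈ , a∈X = unresize a∈ in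
              resize (X , X∈ , Filter.upward (proj₁ X) a≤b a∈X)
          }

        bound : Between
        bound = ⋃-filter , (λ a∈F → resize (least , inj₂ ≡-refl , a∈F)) ,
          λ a∈ → let X , _ , a∈X = unresize a∈ in proj₂ (proj₂ X) a∈X

    -- The predicate is left arbitrary to serve twice: nonzero elements give ultrafilters, and
    -- antecedents admissible for a pair `x`, `y` give minimal members of `𝐂 x y`.
    maximalFilterWithin :
      ∃[ M ] (members F ⊆ members M × members M ⊆ Q ×
        (∀ G → members M ⊆ members G → members G ⊆ Q → members G ⊆ members M))
    maximalFilterWithin =
      let (M , F⊆M , M⊆Q) , maximal = zorn order λ C chain →
            let open Union C chain in bound , λ {X} X∈C a∈X → resize (X , inj₁ X∈C , a∈X)
      in M , F⊆M , M⊆Q , λ G M⊆G G⊆Q → maximal {G , (λ p → M⊆G (F⊆M p)) , G⊆Q} M⊆G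

  -- The ultrafilter theorem, primeness and separation.

  ultrafilterExtension : ∀ F → Proper 𝐀 F → ∃[ u ] (u ∈ φ 𝐀 F)
  ultrafilterExtension F ⊥∉F =
    -- Properness of a filter amounts to all its members being nonzero, which is containment in a
    -- fixed predicate.
    let M , F⊆M , M⊆Q , maximal = maximalFilterWithin (λ a → ¬ (a ≈ ⊥)) F (nonzero F ⊥∉F)
    in record
      { filter  = M
      ; proper  = λ ⊥∈M → M⊆Q ⊥∈M refl
      ; maximal = λ G ⊥∉G M⊆G → maximal G M⊆G (nonzero G ⊥∉G)
      } , F⊆M
    where
    nonzero : ∀ G → Proper 𝐀 G → members G ⊆ λ a → ¬ (a ≈ ⊥)
    nonzero G ⊥∉G a∈G a≈⊥ = ⊥∉G (≈-mem G a≈⊥ a∈G)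

  module _ (u : Ultrafilter 𝐀) where
    open Ultrafilter u using (filter; proper; maximal)
    open Filter filter using (∧-mem; upward)

    ∈⇒∁∉ : ∀ {a} → a ∈ elements u → ∁ a ∉ elements u
    ∈⇒∁∉ {a} a∈u ∁a∈u = proper (≈-mem filter (∧-complementʳ a) (∧-mem a∈u ∁a∈u))

    -- If adjoining `a` is inconsistent, some member of `u` is disjoint from `a` and so below `∁ a`;
    -- otherwise maximality would put `a` in `u`.
    ∉⇒∁∈ : ∀ {a} → a ∉ elements u → ∁ a ∈ elements u
    ∉⇒∁∈ {a} a∉u with em {P = ⊥ ∈ members (filter ∨ᶠ ↑ a)}
    ... | yes (f , g , f∈u , lift a≤g , fg≤⊥) =
      upward (∧-⊥⇒≤∁ (≤-trans (∧-mono ≤-refl a≤g) fg≤⊥)) f∈u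
    ... | no ⊥∉ = contradiction
      (maximal (filter ∨ᶠ ↑ a) ⊥∉ (⊆-∨ᶠˡ filter (↑ a)) (⊆-∨ᶠʳ filter (↑ a) (lift ≤-refl))) a∉u

    ∨-prime : ∀ {a b} → (a ∨ b) ∈ elements u → a ∈ elements u ⊎ b ∈ elements u
    ∨-prime {a} {b} a∨b∈u with em {P = a ∈ elements u} | em {P = b ∈ elements u}
    ... | yes a∈u | _       = inj₁ a∈u
    ... | no _    | yes b∈u = inj₂ b∈u
    ... | no a∉u  | no b∉u  = contradiction
      (≈-mem filter (sym (deMorgan₂ a b)) (∧-mem (∉⇒∁∈ a∉u) (∉⇒∁∈ b∉u))) (∈⇒∁∉ a∨b∈u)

  -- Adjoining `∁ a` keeps `F` proper: a member `f` with `f ∧ ∁ a ≤ ⊥` would lie below `a`.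
  separation : ∀ F {a} → a ∉ members F → ∃[ u ] (u ∈ φ 𝐀 F × a ∉ elements u)
  separation F {a} a∉F =
    let u , F∁a⊆u = ultrafilterExtension (F ∨ᶠ ↑ (∁ a)) λ where
          (f , g , f∈F , lift ∁a≤g , fg≤⊥) →
            a∉F (Filter.upward F (∧-∁-⊥⇒≤ (≤-trans (∧-mono ≤-refl ∁a≤g) fg≤⊥)) f∈F)
    in u , (λ f∈F → F∁a⊆u (⊆-∨ᶠˡ F (↑ (∁ a)) f∈F)) ,
       λ a∈u → ∈⇒∁∉ u a∈u (F∁a⊆u (⊆-∨ᶠʳ F (↑ (∁ a)) (lift ≤-refl)))

  -- This turns inclusions between closed sets into reverse inclusions between their filters.
  ∈-allUltrafilters⇒∈ : ∀ F {a} → (∀ u → u ∈ φ 𝐀 F → a ∈ elements u) → a ∈ members F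
  ∈-allUltrafilters⇒∈ F {a} h = decidable-stable em λ a∉F →
    let u , F⊆u , a∉u = separation F a∉F in a∉u (h u F⊆u)

  -- For fixed `x` and `y`, the condition `D 𝐀 x G ⊆ elements y` constrains the members of `G` one
  -- at a time, so it is containment in a predicate. Maximal filters within that predicate
  -- correspond to minimal closed sets.
  minimalWitness : ∀ x {b d} → (b ⟶ d) ∉ elements x →
    ∃[ y ] ∃[ G ] (d ∉ elements y × b ∈ members G × D 𝐀 x G ⊆ elements y ×
      IsMinimalIn 𝐀 (𝐂 𝐀 x y) (φ 𝐀 G))
  minimalWitness x {b} {d} b⟶d∉x =
    let y , D⊆y , d∉y = separation (D-filter x (↑ b)) λ (a , lift b≤a , a⟶d∈x) →
          b⟶d∉x (Filter.upward (Ultrafilter.filter x) (⟶-antiˡ d b≤a) a⟶d∈x)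
        G , ↑b⊆G , G⊆Q , maximal =
          maximalFilterWithin (λ a → ∀ e → (a ⟶ e) ∈ elements x → e ∈ elements y) (↑ b)
            (λ a∈ e a⟶e∈x → D⊆y (_ , a∈ , a⟶e∈x))
        DG⊆y : D 𝐀 x G ⊆ elements y
        DG⊆y = λ (a , a∈G , a⟶e∈x) → G⊆Q a∈G _ a⟶e∈x
    in y , G , d∉y , ↑b⊆G (lift ≤-refl) , DG⊆y ,
       ((G , (λ p → p) , (λ p → p)) , G , ((λ p → p) , (λ p → p)) , DG⊆y) ,
       -- A competitor `φ H` inside `φ G` has `G` inside `H`; maximality of `G` then forces `H` back
       -- inside `G`.
       λ W (_ , H , (W⊆φH , φH⊆W) , DH⊆y) W⊆φG {u} u∈φG →
         φH⊆W λ h∈H → u∈φG (maximal H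
           (λ a∈G → ∈-allUltrafilters⇒∈ H λ v v∈φH → W⊆φG {v} (φH⊆W v∈φH) a∈G)
           (λ a∈H e a⟶e∈x → DH⊆y (_ , a∈H , a⟶e∈x)) h∈H)

  -- From T-closed sets to congruences.

  TClosedToCongruence : TClosedSet 𝐀 → Congruence 𝐀
  TClosedToCongruence Y = record
    { _∼_           = λ a b → Resize (Agree a b)
    ; isEquivalence = record
      { refl  = resize λ u _ → (λ p → p) , (λ p → p)
      ; sym   = λ a∼b → resize λ u u∈Y → swap (unresize a∼b u u∈Y)
      ; trans = λ a∼b b∼d → resize λ u u∈Y →
          let f , g = unresize a∼b u u∈Y
              h , k = unresize b∼d u u∈Y
          in (λ p → h (f p)) , (λ p → g (k p))
      }
    ; ≈⇒∼           = λ a≈b → resize λ u _ →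
        ≈-mem (Ultrafilter.filter u) a≈b , ≈-mem (Ultrafilter.filter u) (sym a≈b)
    ; ∨-compat      = λ a∼b d∼e → resize λ u u∈Y →
        let f , g = unresize a∼b u u∈Y
            h , k = unresize d∼e u u∈Y
        in ∨-map u f h , ∨-map u g k
    ; ∧-compat      = λ a∼b d∼e → resize λ u u∈Y →
        let f , g = unresize a∼b u u∈Y
            h , k = unresize d∼e u u∈Y
        in ∧-map u f h , ∧-map u g k
    ; ∁-compat      = λ a∼b → resize λ u u∈Y →
        let f , g = unresize a∼b u u∈Y in ∁-map u g , ∁-map u f
    ; ⟶-compat      = λ a∼b d∼e → resize λ u u∈Y →
        let ab = unresize a∼b
            de = unresize d∼e
        in ⟶-map u u∈Y (λ v v∈Y → proj₂ (ab v v∈Y)) (λ v v∈Y → proj₁ (de v v∈Y)) ,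
           ⟶-map u u∈Y (λ v v∈Y → proj₁ (ab v v∈Y)) (λ v v∈Y → proj₂ (de v v∈Y))
    }
    where
    open TClosedSet Y

    Agree : Carrier → Carrier → Set (lsuc (c ⊔ ℓ))
    Agree a b = ∀ u → u ∈ points →
      (a ∈ elements u → b ∈ elements u) × (b ∈ elements u → a ∈ elements u)

    ∨-map : ∀ u {a b d e} → (a ∈ elements u → b ∈ elements u) →
      (d ∈ elements u → e ∈ elements u) → (a ∨ d) ∈ elements u → (b ∨ e) ∈ elements u
    ∨-map u f h a∨d∈u with ∨-prime u a∨d∈u
    ... | inj₁ a∈u = Filter.upward (Ultrafilter.filter u) (x≤x∨y _ _) (f a∈u)
    ... | inj₂ d∈u = Filter.upward (Ultrafilter.filter u) (y≤x∨y _ _) (h d∈u)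

    ∧-map : ∀ u {a b d e} → (a ∈ elements u → b ∈ elements u) →
      (d ∈ elements u → e ∈ elements u) → (a ∧ d) ∈ elements u → (b ∧ e) ∈ elements u
    ∧-map u f h a∧d∈u = ∧-mem (f (upward (x∧y≤x _ _) a∧d∈u)) (h (upward (x∧y≤y _ _) a∧d∈u))
      where open Filter (Ultrafilter.filter u) using (∧-mem; upward)

    ∁-map : ∀ u {a b} → (b ∈ elements u → a ∈ elements u) → ∁ a ∈ elements u → ∁ b ∈ elements u
    ∁-map u g ∁a∈u = ∉⇒∁∈ u λ b∈u → ∈⇒∁∉ u (g b∈u) ∁a∈u

    ⟶-map : ∀ x → x ∈ points → ∀ {a b d e} →
      (∀ u → u ∈ points → b ∈ elements u → a ∈ elements u) →
      (∀ u → u ∈ points → d ∈ elements u → e ∈ elements u) →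
      (a ⟶ d) ∈ elements x → (b ⟶ e) ∈ elements x
    ⟶-map x x∈Y {a} b⇒a d⇒e a⟶d∈x = decidable-stable em λ b⟶e∉x →
      let y , G , e∉y , b∈G , D⊆y , minimal = minimalWitness x b⟶e∉x
          φG⊆Y , y∈Y = Tclosed x y (φ 𝐀 G) x∈Y minimal
          -- Every point of `φ G` contains `b` and lies in `Y`, hence contains `a`.
          a∈G = ∈-allUltrafilters⇒∈ G λ u u∈φG → b⇒a u (φG⊆Y {u} u∈φG) (u∈φG b∈G)
      in e∉y (d⇒e y y∈Y (D⊆y (a , a∈G , a⟶d∈x)))

  -- The lattice of congruences.

  module _ {p} (𝒮 : Pred (Congruence 𝐀) p) where

    -- Families of any size are allowed so that a join can be the intersection of all upper bounds;
    -- resizing absorbs the impredicativity.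
    ⋂ : Congruence 𝐀
    ⋂ = record
      { _∼_           = λ a b → Resize (∀ χ → χ ∈ 𝒮 → Congruence._∼_ χ a b)
      ; isEquivalence = record
        { refl  = resize λ χ _ → IsEquivalence.refl (Congruence.isEquivalence χ)
        ; sym   = λ r → resize λ χ χ∈ → IsEquivalence.sym (Congruence.isEquivalence χ) (unresize r χ χ∈)
        ; trans = λ r s → resize λ χ χ∈ →
            IsEquivalence.trans (Congruence.isEquivalence χ) (unresize r χ χ∈) (unresize s χ χ∈)
        }
      ; ≈⇒∼           = λ a≈b → resize λ χ _ → ≈⇒∼ χ a≈b
      ; ∨-compat      = λ r s → resize λ χ χ∈ → ∨-compat χ (unresize r χ χ∈) (unresize s χ χ∈)
      ; ∧-compat      = λ r s → resize λ χ χ∈ → ∧-compat χ (unresize r χ χ∈) (unresize s χ χ∈)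
      ; ∁-compat      = λ r → resize λ χ χ∈ → ∁-compat χ (unresize r χ χ∈)
      ; ⟶-compat      = λ r s → resize λ χ χ∈ → ⟶-compat χ (unresize r χ χ∈) (unresize s χ χ∈)
      }
      where open Congruence

  congruenceLattice : LatticeOn (congruencePoset 𝐀)
  congruenceLattice = record
    { _∨_       = λ θ ψ → ⋂ λ χ → θ ⊑ χ × ψ ⊑ χ
    ; _∧_       = λ θ ψ → ⋂ λ χ → χ ≡ θ ⊎ χ ≡ ψ
    ; isLattice = record
      { isPartialOrder = Poset.isPartialOrder (congruencePoset 𝐀)
      ; supremum = λ θ ψ →
          (λ r → resize λ χ (θ⊑χ , _) → θ⊑χ r) ,
          (λ r → resize λ χ (_ , ψ⊑χ) → ψ⊑χ r) ,
          λ χ θ⊑χ ψ⊑χ r → unresize r χ (θ⊑χ , ψ⊑χ)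
      ; infimum = λ θ ψ →
          (λ r → unresize r θ (inj₁ ≡-refl)) ,
          (λ r → unresize r ψ (inj₂ ≡-refl)) ,
          λ χ χ⊑θ χ⊑ψ r → resize λ where
            _ (inj₁ ≡-refl) → χ⊑θ r
            _ (inj₂ ≡-refl) → χ⊑ψ r
      }
    }
    where open Poset (congruencePoset 𝐀) using () renaming (_≤_ to _⊑_)

  -- The two maps are mutually inverse.

  TClosed-roundTrip : ∀ Y → TClosedSet.points (congruenceToTClosed (TClosedToCongruence Y))
    ≐ TClosedSet.points Y
  TClosed-roundTrip Y =
    -- Closedness recovers `Y`: each member of its defining filter agrees with `⊤` throughout `Y`,
    -- so `u` contains that filter.
    (λ {u} u∈ → proj₂ Y≐φF λ a∈F → u∈ (resize λ v v∈Y →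
      (λ _ → Filter.⊤-mem (Ultrafilter.filter v)) , λ _ → proj₁ Y≐φF v∈Y a∈F)) ,
    λ {u} u∈Y a∼⊤ → proj₂ (unresize a∼⊤ u u∈Y) (Filter.⊤-mem (Ultrafilter.filter u))
    where Y≐φF = proj₂ (TClosedSet.closed Y)

  -- Agreement at all ultrafilters above the class of `⊤` puts both implications in that class,
  -- which determines `θ`.
  congruence-roundTrip : ∀ θ →
    Poset._≈_ (congruencePoset 𝐀) (TClosedToCongruence (congruenceToTClosed θ)) θ
  congruence-roundTrip θ =
    (λ r → ∁∨∼⊤⇒∼ θ
      (implication λ u u∈ → proj₁ (unresize r u u∈))
      (implication λ u u∈ → proj₂ (unresize r u u∈))) ,
    λ a∼b → resize λ u u∈ →
      modusPonens u (u∈ (∼⇒∁∨∼⊤ θ a∼b)) ,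
      modusPonens u (u∈ (∼⇒∁∨∼⊤ θ (IsEquivalence.sym (Congruence.isEquivalence θ) a∼b)))
    where
    modusPonens : ∀ u {a b} → (∁ a ∨ b) ∈ elements u → a ∈ elements u → b ∈ elements u
    modusPonens u ∁a∨b∈u a∈u with ∨-prime u ∁a∨b∈u
    ... | inj₁ ∁a∈u = contradiction ∁a∈u (∈⇒∁∉ u a∈u)
    ... | inj₂ b∈u  = b∈u

    implication : ∀ {a b} → (∀ u → u ∈ φ 𝐀 (⊤-class θ) → a ∈ elements u → b ∈ elements u) →
      (∁ a ∨ b) ∈ members (⊤-class θ)
    implication {a} {b} h = ∈-allUltrafilters⇒∈ (⊤-class θ) λ u u∈ → case u u∈ em
      where
      case : ∀ u → u ∈ φ 𝐀 (⊤-class θ) → Dec (a ∈ elements u) → (∁ a ∨ b) ∈ elements u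
      case u u∈ (yes a∈u) = Filter.upward (Ultrafilter.filter u) (y≤x∨y _ _) (h u u∈ a∈u)
      case u u∈ (no  a∉u) = Filter.upward (Ultrafilter.filter u) (x≤x∨y _ _) (∉⇒∁∈ u a∉u)

theorem8p4 : (∀ {a} → ExcludedMiddle a) →
    (∀ {a ℓ₁ ℓ₂ p} → ZornsLemma a ℓ₁ ℓ₂ p) →
    ∀ {c ℓ} (𝐀 : ConditionalAlgebra c ℓ) →
    Σ[ Con ∈ LatticeOn (congruencePoset 𝐀) ]
    Σ[ TCl ∈ LatticeOn (TClosedPoset 𝐀) ]
    Σ[ f ∈ (Congruence 𝐀 → TClosedSet 𝐀) ]
    IsDualLatticeIsomorphism (LatticeOn.lattice Con) (LatticeOn.lattice TCl) f
theorem8p4 em zorn 𝐀 =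
  congruenceLattice , latticeOn , congruenceToTClosed , isDualLatticeIsomorphism
  where
  open FilterOperations 𝐀 using (congruenceToTClosed)
  open ClassicalDuality em zorn 𝐀
  open DualTransfer {P = congruencePoset 𝐀} {Q = TClosedPoset 𝐀} congruenceLattice
    congruenceToTClosed TClosedToCongruence
    (λ θ ψ θ⊑ψ {u} u∈ a∼⊤ → u∈ (θ⊑ψ a∼⊤))
    (λ X Y X⊆Y r → resize λ u u∈X → unresize r u (X⊆Y u∈X))
    TClosed-roundTrip congruence-roundTrip
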